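{- Let $G$ be a group and let $X$ be an infinite transitive $G$-space. Then there exists a $G$-selective ultrafilter $\mathcal{U}$ on $X$.
   Context: A $G$-space is a set $X$ with an action $G\times X\to X$, $(g,x)\mapsto gx$, of the group $G$; it is transitive if for any $x,y\in X$ there exists $g\in G$ with $gx=y$. A partition $\mathcal{P}$ of $X$ is $G$-invariant if $gP\in\mathcal{P}$ for all $g\in G$ and $P\in\mathcal{P}$. An ultrafilter is free if it is non-principal. A free ultrafilter $\mathcal{U}$ on an infinite $G$-space $X$ is $G$-selective if, for every $G$-invariant partition $\mathcal{P}$ of $X$, either some cell of $\mathcal{P}$ is a member of $\mathcal{U}$, or there exists $U\in\mathcal{U}$ such that $|P\cap U|\leqslant 1$ for each $P\in\mathcal{P}$. The result is a theorem of ZFC, with no additional set-theoretic assumptions. -}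

module Defs where

open import Algebra.Bundles using (Group)
open import Data.Fin.Base using (Fin)
open import Data.Nat.Base using (ℕ)
open import Data.Product.Base using (∃; _×_)
open import Data.Sum.Base using (_⊎_)
open import Function.Bundles using (_⇔_; _↔_)
open import Level using (Level; _⊔_; suc)
open import Relation.Binary.Core using (Rel)
open import Relation.Binary.Definitions using (_Respects_)
open import Relation.Binary.PropositionalEquality.Core using (_≡_)
open import Relation.Binary.Structures using (IsEquivalence)
open import Relation.Nullary.Negation.Core using (¬_)
open import Relation.Unary using (Pred; _∈_; _∉_; _⊆_; _≐_; _∩_; ∁; _≬_; Satisfiable)
open import Relation.Unary.Polymorphic using (∅; U)

private
  variable
    a c ℓ : Level

-- Every partition, given as the classes of an equivalence relation, has a
-- system of representatives (Zermelo's 1908 form of the axiom of choice).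
-- Unlike the choice principle provable from Σ-types, the chosen
-- representative depends on the class only, not on the element presenting it.
AxiomOfChoice : ∀ a ℓ → Set (suc (a ⊔ ℓ))
AxiomOfChoice a ℓ =
  {A : Set a} {_∼_ : Rel A ℓ} → IsEquivalence _∼_ →
  ∃ λ (rep : A → A) → (∀ x → rep x ∼ x) × (∀ {x y} → x ∼ y → rep x ≡ rep y)

Infinite : Set a → Set a
Infinite X = ¬ (∃ λ (n : ℕ) → Fin n ↔ X)

-- Under excluded middle every proposition is equivalent to one in the lowest
-- universe, so fixing the levels here does not exclude any subset or family.
Subset : Set a → Set (suc a)
Subset {a} X = Pred X a

Family : Set a → Set (suc a)
Family {a} X = Pred (Subset X) a

record IsPartition {X : Set a} (𝒫 : Family X) : Set (suc a) where
  field
    -- 𝒫 is a set of subsets, and subsets are equal when they have the same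
    -- elements.
    respects : 𝒫 Respects _≐_
    nonEmpty : ∀ {P} → P ∈ 𝒫 → Satisfiable P
    disjoint : ∀ {P Q} → P ∈ 𝒫 → Q ∈ 𝒫 → P ≬ Q → P ≐ Q
    covers   : ∀ x → ∃ λ P → P ∈ 𝒫 × x ∈ P

record IsUltrafilter {X : Set a} (𝒰 : Family X) : Set (suc a) where
  field
    whole    : U ∈ 𝒰
    proper   : ∅ ∉ 𝒰
    upward   : ∀ {A B} → A ⊆ B → A ∈ 𝒰 → B ∈ 𝒰
    meet     : ∀ {A B} → A ∈ 𝒰 → B ∈ 𝒰 → (A ∩ B) ∈ 𝒰
    decides  : ∀ A → A ∈ 𝒰 ⊎ ∁ A ∈ 𝒰

Principal : {X : Set a} → Family X → Set (suc a)
Principal {X = X} 𝒰 = ∃ λ (x : X) → ∀ A → A ∈ 𝒰 ⇔ x ∈ A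

record IsFreeUltrafilter {X : Set a} (𝒰 : Family X) : Set (suc a) where
  field
    isUltrafilter : IsUltrafilter 𝒰
    free          : ¬ Principal 𝒰

record GSpace (G : Group c ℓ) (a : Level) : Set (c ⊔ ℓ ⊔ suc a) where
  open Group G using (_≈_; _∙_; ε) renaming (Carrier to ∣G∣)
  infixr 8 _·_
  field
    Carrier    : Set a
    _·_        : ∣G∣ → Carrier → Carrier
    ·-cong     : ∀ {g h} → g ≈ h → ∀ x → g · x ≡ h · x
    ·-identity : ∀ x → ε · x ≡ x
    ·-assoc    : ∀ g h x → (g ∙ h) · x ≡ g · (h · x)

module _ {G : Group c ℓ} (X : GSpace G a) where
  open Group G using () renaming (Carrier to ∣G∣)
  open GSpace X using (_·_) renaming (Carrier to ∣X∣)

  Transitive : Set (c ⊔ a)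
  Transitive = ∀ x y → ∃ λ g → g · x ≡ y

  translate : ∣G∣ → Subset ∣X∣ → Subset ∣X∣
  translate g P y = ∃ λ x → x ∈ P × g · x ≡ y

  Invariant : Family ∣X∣ → Set (c ⊔ suc a)
  Invariant 𝒫 = ∀ g {P} → P ∈ 𝒫 → translate g P ∈ 𝒫

  -- The second alternative says that ∣ P ∩ V ∣ ≤ 1 for every cell P.
  record IsSelective (𝒰 : Family ∣X∣) : Set (c ⊔ suc a) where
    field
      isFreeUltrafilter : IsFreeUltrafilter 𝒰
      selective : ∀ (𝒫 : Family ∣X∣) → IsPartition 𝒫 → Invariant 𝒫 →
        (∃ λ P → P ∈ 𝒫 × P ∈ 𝒰) ⊎
        (∃ λ V → V ∈ 𝒰 × (∀ {P} → P ∈ 𝒫 →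
          ∀ {x y} → x ∈ P ∩ V → y ∈ P ∩ V → x ≡ y))

{-# OPTIONS --safe #-}
-- Fix x₀ ∈ X; a subset B is a block if x₀ ∈ B and every g mapping some point of B
-- into B maps all of B into B.  Take a maximal family 𝓕 of infinite blocks
-- closed under intersection, and extend it to a filter 𝓜 maximal among those
-- whose members are all infinite; 𝓜 is a free ultrafilter.
-- The cell C of x₀ in an invariant partition is a block, so C ∈ 𝓕 or C ∩ D is
-- finite for some D ∈ 𝓕.  In the second case any g with g x₀ ∈ D maps C ∩ D
-- onto the intersection of D with the cell of g x₀.  Hence D has a colouring by
-- the finite set C ∩ D that is injective on each cell, and some colour class
-- belongs to the ultrafilter.
module Submission where

open import Algebra.Bundles using (Group)
open import Axiom.ExcludedMiddle using (ExcludedMiddle)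
open import Data.Fin.Base as Fin using (Fin; zero)
open import Data.List.Base using (List; []; _∷_; _++_; foldr; lookup; length; deduplicate)
open import Data.List.Membership.Propositional using () renaming (_∈_ to _∈ˡ_)
open import Data.List.Membership.Propositional.Properties
  using (∈-lookup; ∈-++⁺ˡ; ∈-++⁺ʳ; ∈-deduplicate⁺)
open import Data.List.Relation.Unary.All as All using (All; []; _∷_)
open import Data.List.Relation.Unary.AllPairs using (_∷_)
open import Data.List.Relation.Unary.Any using (here; there; index)
open import Data.List.Relation.Unary.Any.Properties using (lookup-index)
open import Data.List.Relation.Unary.Unique.Propositional using (Unique)
import Data.List.Relation.Unary.Unique.DecPropositional.Properties as DecUnique
open import Data.Product.Base using (Σ; ∃; _×_; _,_; proj₁; proj₂)
open import Data.Sum.Base using (_⊎_; inj₁; inj₂; [_,_]′)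
open import Data.Unit.Polymorphic.Base using (tt)
open import Function.Base using (_∘_; id)
open import Function.Bundles using (mk↔ₛ′; Equivalence)
open import Level using (Level; Lift; lift; _⊔_; suc)
open import Relation.Binary.Definitions using (DecidableEquality)
open import Relation.Binary.PropositionalEquality
  using (_≡_; refl; sym; trans; cong; subst; module ≡-Reasoning)
open import Relation.Nullary.Decidable.Core using (True; toWitness; fromWitness; yes; no)
open import Relation.Nullary.Negation.Core using (¬_; contradiction)
open import Relation.Unary
  using (Pred; _∈_; _∉_; _⊆_; _≐_; _∩_; _∪_; ∁; ｛_｝; Satisfiable)
open import Relation.Unary.Polymorphic using (U)
open import Relation.Unary.Properties using (≐-refl; ≐-sym; ≐-trans)
open import Defs

private
  variable
    a b c f ℓ m : Level

-- Finite sets as covering lists.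

lookup-injective : {A : Set a} {xs : List A} → Unique xs →
  ∀ i j → lookup xs i ≡ lookup xs j → i ≡ j
lookup-injective (_ ∷ _)   zero        zero        _  = refl
lookup-injective (x∉ ∷ _)  zero        (Fin.suc j) eq = contradiction eq (All.lookup x∉ (∈-lookup j))
lookup-injective (x∉ ∷ _)  (Fin.suc i) zero        eq = contradiction (sym eq) (All.lookup x∉ (∈-lookup i))
lookup-injective (_ ∷ uxs) (Fin.suc i) (Fin.suc j) eq = cong Fin.suc (lookup-injective uxs i j eq)

-- The list may repeat points and contain points outside `B`, so passing to subsets and unions needs
-- no decision procedure.
Finite : {X : Set a} → Subset X → Set a
Finite {X = X} B = ∃ λ (xs : List X) → B ⊆ (_∈ˡ xs)

module _ {X : Set a} where

  Finite-⊆ : {A B : Subset X} → A ⊆ B → Finite B → Finite A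
  Finite-⊆ A⊆B (xs , B⊆xs) = xs , B⊆xs ∘ A⊆B

  Finite-∪ : {A B : Subset X} → Finite A → Finite B → Finite (A ∪ B)
  Finite-∪ (xs , A⊆xs) (ys , B⊆ys) =
    xs ++ ys , [ ∈-++⁺ˡ ∘ A⊆xs , ∈-++⁺ʳ xs ∘ B⊆ys ]′

  Infinite⇒¬Finite : DecidableEquality X → Infinite X → ¬ Finite {X = X} U
  Infinite⇒¬Finite _≟_ infinite (xs , covers) =
    infinite (length ys , mk↔ₛ′ (lookup ys) (index ∘ mem)
      (λ x → sym (lookup-index (mem x)))
      (λ i → lookup-injective (DecUnique.deduplicate-! _≟_ xs) _ i
               (sym (lookup-index (mem (lookup ys i))))))
    where
    ys = deduplicate _≟_ xs
    mem : ∀ x → x ∈ˡ ys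
    mem x = ∈-deduplicate⁺ _≟_ (covers tt)

  -- Filter bases of infinite sets.

  ⋂ˡ : List (Subset X) → Subset X
  ⋂ˡ = foldr _∩_ U

  record IsFilterBase (F : Pred (Subset X) f) : Set (suc a ⊔ f) where
    field
      whole    : U ∈ F
      meet     : ∀ {A B} → A ∈ F → B ∈ F → A ∩ B ∈ F
      infinite : ∀ {A} → A ∈ F → ¬ Finite A

    ⋂ˡ-closed : ∀ {As} → All F As → ⋂ˡ As ∈ F
    ⋂ˡ-closed []       = whole
    ⋂ˡ-closed (p ∷ ps) = meet p (⋂ˡ-closed ps)

  -- Maximality appears through its usable consequence: what keeps a set of `𝓑` out of `F` is a
  -- single almost disjoint member.
  record IsMaximalIn (𝓑 : Pred (Subset X) b) (F : Pred (Subset X) f) : Set (suc a ⊔ b ⊔ f) where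
    field
      isFilterBase : IsFilterBase F
      within       : F ⊆ 𝓑
      maximal      : ∀ {A} → A ∈ 𝓑 → A ∈ F ⊎ ∃ λ D → D ∈ F × Finite (A ∩ D)
    open IsFilterBase isFilterBase public

  fibre∈ultrafilter : {𝒰 : Family X} → IsUltrafilter 𝒰 → (h : X → X) →
    ∀ xs → (λ z → h z ∈ˡ xs) ∈ 𝒰 → ∃ λ e → (λ z → h z ≡ e) ∈ 𝒰
  fibre∈ultrafilter ultra h [] h∈ = contradiction (upward (λ ()) h∈) proper
    where open IsUltrafilter ultra
  fibre∈ultrafilter ultra h (e ∷ xs) h∈ with IsUltrafilter.decides ultra (λ z → h z ≡ e)
  ... | inj₁ p = e , p
  ... | inj₂ ¬p = fibre∈ultrafilter ultra h xs
    (upward (λ where (here eq , ≢e) → contradiction eq ≢e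
                     (there i , _)  → i)
            (meet h∈ ¬p))
    where open IsUltrafilter ultra

-- Resizing, extensional choice and maximality.

module Classical (em : ∀ ℓ → ExcludedMiddle ℓ) (ac : ∀ a ℓ → AxiomOfChoice a ℓ) where

  -- Excluded middle replaces a proposition by a truth value in the lowest universe, which keeps
  -- unions over large families at a fixed level.
  Resize : ∀ m → Set ℓ → Set m
  Resize m P = Lift m (True (em _ {P}))

  resize : {P : Set ℓ} → P → Resize m P
  resize p = lift (fromWitness p)

  unresize : {P : Set ℓ} → Resize m P → P
  unresize (lift t) = toWitness t

  module Choose {A : Set a} {ℓ : Level} where

    private
      choice = ac _ _ {Σ (Pred A ℓ) Satisfiable} {λ P Q → proj₁ P ≐ proj₁ Q}
        record { refl = ≐-refl ; sym = ≐-sym ; trans = ≐-trans }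

    -- Representatives are taken among inhabited predicates modulo `≐`, each carrying its own
    -- witness; hence the element chosen depends only on the extension of `P`.
    choose : (P : Pred A ℓ) → Satisfiable P → A
    choose P p = proj₁ (proj₂ (proj₁ choice (P , p)))

    choose-∈ : ∀ P p → choose P p ∈ P
    choose-∈ P p =
      proj₁ (proj₁ (proj₂ choice) (P , p)) (proj₂ (proj₂ (proj₁ choice (P , p))))

    choose-cong : ∀ {P Q} p q → P ≐ Q → choose P p ≡ choose Q q
    choose-cong p q P≐Q = cong (proj₁ ∘ proj₂) (proj₂ (proj₂ choice) P≐Q)

  -- The Teichmüller–Tukey lemma: the tower generated by adjoining one chosen
  -- element at a time is a chain, so its union is consistent and a fixed point.
  module Tukey {A : Set a} (Good : List A → Set b) where

    open Choose

    Sub : Set (suc (a ⊔ b))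
    Sub = Pred A (a ⊔ b)

    Consistent : Sub → Set (a ⊔ b)
    Consistent M = ∀ {xs} → All M xs → Good xs

    Addable : Sub → Sub
    Addable M x = x ∉ M × Consistent (M ∪ ｛ x ｝)

    next : Sub → Sub
    next M x = x ∈ M ⊎ Σ (Satisfiable (Addable M)) λ p → x ≡ choose (Addable M) p

    ⋃ᵣ : Pred Sub (a ⊔ b) → Sub
    ⋃ᵣ S x = Resize (a ⊔ b) (∃ λ M → M ∈ S × x ∈ M)

    data Tower : Sub → Set (suc (a ⊔ b)) where
      next⁺ : ∀ {M} → Tower M → Tower (next M)
      ⋃⁺    : ∀ S → (∀ {M} → M ∈ S → Tower M) → Tower (⋃ᵣ S)

    consistent-⊆ : ∀ {M N} → M ⊆ N → Consistent N → Consistent M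
    consistent-⊆ M⊆N con = con ∘ All.map M⊆N

    addable-⊆ : ∀ {M N} → M ≐ N → Addable M ⊆ Addable N
    addable-⊆ (M⊆N , N⊆M) (x∉M , con) =
      x∉M ∘ N⊆M , consistent-⊆ [ inj₁ ∘ N⊆M , inj₂ ]′ con

    next-⊆ : ∀ {M N} → M ≐ N → next M ⊆ next N
    next-⊆ M≐N (inj₁ x∈M)            = inj₁ (proj₁ M≐N x∈M)
    next-⊆ M≐N (inj₂ ((y , p) , eq)) = inj₂ ((y , addable-⊆ M≐N p) ,
      trans eq (choose-cong _ _ (addable-⊆ M≐N , addable-⊆ (≐-sym M≐N))))

    -- Having `next N` rather than `N` in the second alternative is what carries the induction
    -- through successors. There, both orders are compared; if `M` and `N` include each other,
    -- extensional choice makes their successors agree.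
    compare : ∀ {M N} → Tower M → Tower N → M ⊆ N ⊎ next N ⊆ M
    compare (next⁺ t) u with compare t u | compare u t
    ... | inj₂ sN⊆M | _          = inj₂ (inj₁ ∘ sN⊆M)
    ... | inj₁ M⊆N  | inj₁ N⊆M  = inj₂ (next-⊆ (N⊆M , M⊆N))
    ... | inj₁ _    | inj₂ sM⊆N = inj₁ sM⊆N
    compare {N = N} (⋃⁺ S t) u with em _ {∃ λ M → M ∈ S × next N ⊆ M}
    ... | yes (M , M∈S , sN⊆M) = inj₂ (λ x∈ → resize (M , M∈S , sN⊆M x∈))
    ... | no  none = inj₁ λ x∈ → below (unresize x∈)
      where
      below : ∀ {x} → (∃ λ M → M ∈ S × x ∈ M) → x ∈ N
      below (M , M∈S , x∈M) with compare (t M∈S) u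
      ... | inj₁ M⊆N  = M⊆N x∈M
      ... | inj₂ sN⊆M = contradiction (M , M∈S , λ {x} → sN⊆M {x}) none

    total : ∀ {M N} → Tower M → Tower N → M ⊆ N ⊎ N ⊆ M
    total t u with compare t u
    ... | inj₁ M⊆N  = inj₁ M⊆N
    ... | inj₂ sN⊆M = inj₂ (sN⊆M ∘ inj₁)

    -- In a chain, finitely many members of the union already lie in one stage. The empty list
    -- stands apart because `S` may be empty.
    All-⋃ᵣ⁻ : ∀ S → (∀ {M} → M ∈ S → Tower M) → ∀ {xs} → All (⋃ᵣ S) xs →
      xs ≡ [] ⊎ ∃ λ M → M ∈ S × All M xs
    All-⋃ᵣ⁻ S t [] = inj₁ refl
    All-⋃ᵣ⁻ S t (p ∷ ps) with unresize p | All-⋃ᵣ⁻ S t ps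
    ... | M , M∈S , x∈M | inj₁ refl = inj₂ (M , M∈S , x∈M ∷ [])
    ... | M , M∈S , x∈M | inj₂ (N , N∈S , qs) with total (t M∈S) (t N∈S)
    ...   | inj₁ M⊆N = inj₂ (N , N∈S , M⊆N x∈M ∷ qs)
    ...   | inj₂ N⊆M = inj₂ (M , M∈S , x∈M ∷ All.map N⊆M qs)

    tower-consistent : Good [] → ∀ {M} → Tower M → Consistent M
    tower-consistent good[] {M = .(next M)} (next⁺ {M} t) with em _ {Satisfiable (Addable M)}
    ... | yes p = consistent-⊆
      [ inj₁ , (λ (q , eq) → inj₂ (sym (trans eq (choose-cong q p ≐-refl)))) ]′
      (proj₂ (choose-∈ (Addable M) p))
    ... | no ¬p = consistent-⊆
      [ id , (λ (q , _) → contradiction q ¬p) ]′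
      (tower-consistent good[] t)
    tower-consistent good[] (⋃⁺ S t) ps with All-⋃ᵣ⁻ S t ps
    ... | inj₁ refl           = good[]
    ... | inj₂ (M , M∈S , qs) = tower-consistent good[] (t M∈S) qs

    tukey : Good [] →
      ∃ λ (M : Sub) → Consistent M × (∀ {x} → Consistent (M ∪ ｛ x ｝) → x ∈ M)
    tukey good[] = top , tower-consistent good[] top⁺ , maximal
      where
      top : Sub
      top = ⋃ᵣ (Resize _ ∘ Tower)

      top⁺ : Tower top
      top⁺ = ⋃⁺ _ unresize

      next-top⊆top : next top ⊆ top
      next-top⊆top x∈ = resize (next top , resize (next⁺ top⁺) , x∈)

      maximal : ∀ {x} → Consistent (top ∪ ｛ x ｝) → x ∈ top
      maximal {x} con with em _ {x ∈ top}
      ... | yes x∈top = x∈top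
      -- The element chosen from `Addable top` lies in `next top`, hence in `top`, whereas addable
      -- elements lie outside.
      ... | no  x∉top =
        contradiction (next-top⊆top (inj₂ (p , refl))) (proj₁ (choose-∈ _ p))
        where
        p : Satisfiable (Addable top)
        p = x , x∉top , con

  -- Maximal filter bases and free ultrafilters.

  module _ {X : Set a} where

    maximalFilterBase : (𝓑 : Pred (Subset X) b) → (∀ {A B} → A ∈ 𝓑 → B ∈ 𝓑 → A ∩ B ∈ 𝓑) →
      (F : Pred (Subset X) f) → IsFilterBase F → F ⊆ 𝓑 →
      ∃ λ (M : Pred (Subset X) (suc a ⊔ b ⊔ f)) → F ⊆ M × IsMaximalIn 𝓑 M
    maximalFilterBase 𝓑 𝓑-∩ F base F⊆𝓑 = M , F⊆M , record
      { isFilterBase = isBase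
      ; within       = M⊆𝓑
      ; maximal      = maximal
      }
      where
      open IsFilterBase base

      -- Testing against every `D` in `F` is what forces `F ⊆ M` later.
      Good : List (Subset X) → Set _
      Good As = All 𝓑 As × (∀ {D} → D ∈ F → ¬ Finite (D ∩ ⋂ˡ As))

      good[] : Good []
      good[] = [] , λ D∈F → infinite D∈F ∘ Finite-⊆ (_, tt)

      open Tukey Good using (tukey)
      M   = proj₁ (tukey good[])
      con = proj₁ (proj₂ (tukey good[]))
      max = proj₂ (proj₂ (tukey good[]))

      M⊆𝓑 : M ⊆ 𝓑
      M⊆𝓑 A∈M = All.head (proj₁ (con (A∈M ∷ [])))

      -- All occurrences of `C` collapse into one factor, so consistency of adjoining `C` concerns
      -- only intersections of `C` with lists from `M`.
      remove : ∀ {C As} → All (M ∪ ｛ C ｝) As →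
        ∃ λ Bs → All M Bs × C ∩ ⋂ˡ Bs ⊆ ⋂ˡ As
      remove [] = [] , [] , proj₂
      remove (p ∷ ps) with remove ps
      remove {As = A ∷ _} (inj₁ A∈M ∷ ps) | Bs , qs , sub =
        A ∷ Bs , A∈M ∷ qs , λ (c , x , y) → x , sub (c , y)
      remove (inj₂ refl ∷ ps) | Bs , qs , sub =
        Bs , qs , λ (c , y) → c , sub (c , y)

      add : ∀ {C} → C ∈ 𝓑 →
        (∀ {As D} → All M As → D ∈ F → ¬ Finite (D ∩ (C ∩ ⋂ˡ As))) → C ∈ M
      add C∈𝓑 large = max λ ps →
        All.map [ M⊆𝓑 , (λ where refl → C∈𝓑) ]′ ps ,
        λ D∈F → let (Bs , qs , sub) = remove ps in
          large qs D∈F ∘ Finite-⊆ λ (d , cs) → d , sub cs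

      F⊆M : F ⊆ M
      F⊆M C∈F = add (F⊆𝓑 C∈F) λ ps D∈F →
        proj₂ (con ps) (meet D∈F C∈F) ∘ Finite-⊆ λ ((d , c) , x) → d , c , x

      isBase : IsFilterBase M
      isBase = record
        { whole    = F⊆M whole
        ; meet     = λ A∈M B∈M → add (𝓑-∩ (M⊆𝓑 A∈M) (M⊆𝓑 B∈M)) λ ps D∈F →
            proj₂ (con (A∈M ∷ B∈M ∷ ps)) D∈F ∘
              Finite-⊆ λ (d , a , b , x) → d , (a , b) , x
        ; infinite = λ A∈M →
            proj₂ (con (A∈M ∷ [])) whole ∘ Finite-⊆ λ (_ , a , _) → a
        }

      maximal : ∀ {C} → C ∈ 𝓑 → C ∈ M ⊎ ∃ λ D → D ∈ M × Finite (C ∩ D)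
      maximal {C} C∈𝓑 with em _ {∃ λ D → D ∈ M × Finite (C ∩ D)}
      ... | yes small = inj₂ small
      -- A finite `D ∩ (C ∩ ⋂ˡ As)` would make `D ∩ ⋂ˡ As` a member of `M` meeting `C` in a finite
      -- set.
      ... | no  large = inj₁ (add C∈𝓑 λ {As} {D} ps D∈F fin → large
        ( D ∩ ⋂ˡ As
        , IsFilterBase.meet isBase (F⊆M D∈F) (IsFilterBase.⋂ˡ-closed isBase ps)
        , Finite-⊆ (λ (c , d , x) → d , c , x) fin))

    maximal⇒freeUltrafilter : {M : Pred (Subset X) m} →
      IsMaximalIn (U {ℓ = a}) M → IsFreeUltrafilter {X = X} (Resize a ∘ M)
    maximal⇒freeUltrafilter {M = M} isMaximal = record
      { isUltrafilter = record
        { whole   = resize whole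
        ; proper  = λ ∅∈ → infinite (unresize ∅∈) ([] , λ ())
        ; upward  = λ A⊆B A∈ → resize (upward A⊆B (unresize A∈))
        ; meet    = λ A∈ B∈ → resize (meet (unresize A∈) (unresize B∈))
        ; decides = decides
        }
      ; free = λ (x , x-principal) →
          infinite (unresize (Equivalence.from (x-principal (x ≡_)) refl))
                   (x ∷ [] , λ where refl → here refl)
      }
      where
      open IsMaximalIn isMaximal

      upward : ∀ {A B} → A ⊆ B → A ∈ M → B ∈ M
      upward A⊆B A∈M with maximal tt
      ... | inj₁ B∈M = B∈M
      -- The infinite set `A ∩ D` would sit inside the finite `B ∩ D`.
      ... | inj₂ (D , D∈M , fin) = contradiction
        (Finite-⊆ (λ (a , d) → A⊆B a , d) fin) (infinite (meet A∈M D∈M))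

      decides : ∀ A → A ∈ Resize a ∘ M ⊎ ∁ A ∈ Resize a ∘ M
      decides A with maximal {A} tt | maximal {∁ A} tt
      ... | inj₁ A∈M | _         = inj₁ (resize A∈M)
      ... | inj₂ _   | inj₁ ∁A∈M = inj₂ (resize ∁A∈M)
      ... | inj₂ (D , D∈M , fin) | inj₂ (E , E∈M , fin′) =
        contradiction (Finite-⊆ split (Finite-∪ fin fin′)) (infinite (meet D∈M E∈M))
        where
        split : D ∩ E ⊆ (A ∩ D) ∪ (∁ A ∩ E)
        split {x} (d , e) with em _ {x ∈ A}
        ... | yes x∈A = inj₁ (x∈A , d)
        ... | no  x∉A = inj₂ (x∉A , e)

  -- Blocks and the ultrafilter they generate.

  module _ {G : Group c ℓ} (𝐗 : GSpace G a)
           (infinite : Infinite (GSpace.Carrier 𝐗)) (transitive : Transitive 𝐗) where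

    open Group G using (_∙_; ε; _⁻¹; inverseˡ) renaming (Carrier to ∣G∣)
    open GSpace 𝐗 renaming (Carrier to X)

    act-inverse : ∀ g x → (g ⁻¹) · (g · x) ≡ x
    act-inverse g x = begin
      (g ⁻¹) · (g · x)  ≡⟨ ·-assoc (g ⁻¹) g x ⟨
      (g ⁻¹ ∙ g) · x    ≡⟨ ·-cong (inverseˡ g) x ⟩
      ε · x             ≡⟨ ·-identity x ⟩
      x                 ∎
      where open ≡-Reasoning

    act-injective : ∀ g {x y} → g · x ≡ g · y → x ≡ y
    act-injective g {x} {y} eq =
      trans (sym (act-inverse g x)) (trans (cong ((g ⁻¹) ·_) eq) (act-inverse g y))

    ¬Finite-U : ¬ Finite {X = X} U
    ¬Finite-U = Infinite⇒¬Finite (λ _ _ → em _) infinite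

    point : X
    point with em _ {X}
    ... | yes x = x
    ... | no ¬x = contradiction ([] , λ {x} _ → contradiction x ¬x) ¬Finite-U

    -- Applied to `g` and `g ⁻¹`, stability says that a translate of `B` equals `B` or misses it: a
    -- block of imprimitivity through `point`.
    record IsBlock (B : Subset X) : Set (c ⊔ a) where
      field
        basepoint : point ∈ B
        stable    : ∀ g {x y} → x ∈ B → g · x ∈ B → y ∈ B → g · y ∈ B

    block-∩ : ∀ {A B} → IsBlock A → IsBlock B → IsBlock (A ∩ B)
    block-∩ A B = record
      { basepoint = A.basepoint , B.basepoint
      ; stable    = λ g (x , x′) (gx , gx′) (y , y′) → A.stable g x gx y , B.stable g x′ gx′ y′
      }
      where
      module A = IsBlock A
      module B = IsBlock B

    blocks : ∃ λ (F : Pred (Subset X) (c ⊔ suc a)) →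
      (λ A → ∀ x → x ∈ A) ⊆ F × IsMaximalIn IsBlock F
    -- The whole space is taken up to extensional equality, since `U ∩ U` is not literally `U`.
    blocks = maximalFilterBase IsBlock block-∩ (λ A → ∀ x → x ∈ A)
      record
        { whole    = λ _ → tt
        ; meet     = λ all all′ x → all x , all′ x
        ; infinite = λ all → ¬Finite-U ∘ Finite-⊆ (λ {x} _ → all x)
        }
      λ all → record { basepoint = all _ ; stable = λ _ _ _ _ → all _ }

    open IsMaximalIn (proj₂ (proj₂ blocks))

    ultra : ∃ λ (M : Pred (Subset X) (c ⊔ suc a)) →
      proj₁ blocks ⊆ M × IsMaximalIn (U {ℓ = a}) M
    ultra = maximalFilterBase U (λ _ _ → tt) (proj₁ blocks) isFilterBase _

    𝒰 : Family X
    𝒰 = Resize a ∘ proj₁ ultra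

    𝒰-free : IsFreeUltrafilter 𝒰
    𝒰-free = maximal⇒freeUltrafilter (proj₂ (proj₂ ultra))

    open IsFreeUltrafilter 𝒰-free using (isUltrafilter)
    open IsUltrafilter isUltrafilter using () renaming (upward to 𝒰-upward; meet to 𝒰-meet)

    -- Colouring along an invariant partition.

    module _ (𝒫 : Family X) (isPartition : IsPartition 𝒫) (invariant : Invariant 𝐗 𝒫) where

      open IsPartition isPartition

      cell-unique : ∀ {P Q x} → P ∈ 𝒫 → Q ∈ 𝒫 → x ∈ P → x ∈ Q → P ⊆ Q
      cell-unique P∈ Q∈ x∈P x∈Q = proj₁ (disjoint P∈ Q∈ (_ , x∈P , x∈Q))

      cell-map : ∀ g {P Q x y} → P ∈ 𝒫 → Q ∈ 𝒫 → x ∈ P → g · x ∈ Q → y ∈ P → g · y ∈ Q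
      cell-map g P∈ Q∈ x∈P gx∈Q y∈P =
        cell-unique (invariant g P∈) Q∈ (_ , x∈P , refl) gx∈Q (_ , y∈P , refl)

      module _ {C D : Subset X} (C∈ : C ∈ 𝒫) (point∈C : point ∈ C) (D-block : IsBlock D) where

        -- Membership in D is part of the relation so that points of D are
        -- represented by points of D.
        infix 4 _∼_
        _∼_ : X → X → Set (suc a)
        x ∼ y = (∃ λ P → P ∈ 𝒫 × x ∈ P × y ∈ P) × (x ∈ D → y ∈ D) × (y ∈ D → x ∈ D)

        representatives : ∃ λ (rep : X → X) →
          (∀ x → rep x ∼ x) × (∀ {x y} → x ∼ y → rep x ≡ rep y)
        representatives = ac _ _ record
          { refl  = λ {x} → let (P , P∈ , x∈P) = covers x in (P , P∈ , x∈P , x∈P) , id , id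
          ; sym   = λ ((P , P∈ , x , y) , to , from) → (P , P∈ , y , x) , from , to
          ; trans = λ ((P , P∈ , x , y) , to , from) ((Q , Q∈ , y′ , z) , to′ , from′) →
              (P , P∈ , x , cell-unique Q∈ P∈ y′ y z) , to′ ∘ to , from ∘ from′
          }

        private
          rep     = proj₁ representatives
          rep-∼   = proj₁ (proj₂ representatives)
          rep-≡   = proj₂ (proj₂ representatives)

        mover : X → ∣G∣
        mover x = proj₁ (transitive point x) ⁻¹

        mover-point : ∀ x → mover x · x ≡ point
        mover-point x with transitive point x
        ... | g , refl = act-inverse g point

        -- A single group element, determined by the representative, moves all points of one cell
        -- lying in `D` into `C ∩ D`; the action being injective, it separates them.
        colour : X → X
        colour z = mover (rep z) · z

        colour-∈ : ∀ {z} → z ∈ D → colour z ∈ C ∩ D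
        colour-∈ {z} z∈D with rep-∼ z
        ... | (P , P∈ , r∈P , z∈P) , _ , back =
          cell-map _ P∈ C∈ r∈P (subst C (sym (mover-point _)) point∈C) z∈P ,
          -- The representative lies in `D` with `z` and is moved to `point`, also in `D`, so
          -- stability carries `z` along.
          IsBlock.stable D-block _ (back z∈D)
            (subst D (sym (mover-point _)) (IsBlock.basepoint D-block)) z∈D

        colour-injective : ∀ {P y z} → P ∈ 𝒫 → y ∈ P → z ∈ P → y ∈ D → z ∈ D →
          colour y ≡ colour z → y ≡ z
        colour-injective {P} {y} {z} P∈ y∈P z∈P y∈D z∈D eq = act-injective (mover (rep y))
          (trans eq (cong (λ r → mover r · z)
            (sym (rep-≡ ((P , P∈ , y∈P , z∈P) , (λ _ → z∈D) , (λ _ → y∈D))))))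

      cell-or-transversal : (∃ λ P → P ∈ 𝒫 × P ∈ 𝒰) ⊎
        (∃ λ V → V ∈ 𝒰 × (∀ {P} → P ∈ 𝒫 → ∀ {x y} → x ∈ P ∩ V → y ∈ P ∩ V → x ≡ y))
      cell-or-transversal with covers point
      ... | C , C∈ , point∈C
        with maximal record { basepoint = point∈C ; stable = λ g → cell-map g C∈ C∈ }
      ... | inj₁ C∈F = inj₁ (C , C∈ , resize (proj₁ (proj₂ ultra) C∈F))
      -- The transversal is `D` cut down to one large colour class; `xs` lists the possible colours.
      ... | inj₂ (D , D∈F , xs , C∩D⊆xs) =
        let D-block  = within D∈F
            D∈𝒰      = resize (proj₁ (proj₂ ultra) D∈F)
            (e , e∈) = fibre∈ultrafilter isUltrafilter
                         (colour C∈ point∈C D-block) xs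
                         (𝒰-upward (C∩D⊆xs ∘ colour-∈ C∈ point∈C D-block) D∈𝒰)
        in inj₂ (_ , 𝒰-meet D∈𝒰 e∈ , λ P∈ (x∈P , x∈D , x≡e) (y∈P , y∈D , y≡e) →
             colour-injective C∈ point∈C D-block P∈ x∈P y∈P x∈D y∈D (trans x≡e (sym y≡e)))

    selectiveUltrafilter : ∃ λ 𝒰 → IsSelective 𝐗 𝒰
    selectiveUltrafilter = 𝒰 , record
      { isFreeUltrafilter = 𝒰-free ; selective = cell-or-transversal }

theorem1 : (∀ ℓ → ExcludedMiddle ℓ) → (∀ a ℓ → AxiomOfChoice a ℓ) →
    ∀ {c ℓ a : Level} (G : Group c ℓ) (X : GSpace G a) →
    Infinite (GSpace.Carrier X) → Transitive X →
    ∃ λ 𝒰 → IsSelective X 𝒰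
theorem1 em ac G = Classical.selectiveUltrafilter em ac
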